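{- Let $n,m\ge 1$, let $g_1,\ldots,g_m$ be computable functions from $\mathbb{Z}^{n+1}$ to $\mathbb{Z}^n$, and let $PROG=(S,I,R)$ be the while-loop program with vector of variables $\vec x=(x[1],\ldots,x[n])$ determined by $g_1,\ldots,g_m$. Assume there exist functions $f_1(\vec x),\ldots,f_M(\vec x)$ from $\mathbb{Z}^n$ to $\mathbb{N}$ such that the following holds: for each computational segment $t_1,\ldots,t_L$ with $L\ge 2$ there exists $k$ with $1\le k\le M$ such that the value of $f_k(\vec x)$ in $t_L$ is strictly less than the value of $f_k(\vec x)$ in $t_1$. Then any computation of $PROG$ is finite.
   Context: $\mathbb{N}=\{0,1,2,\ldots\}$. The while-loop program determined by $g_1,\ldots,g_m:\mathbb{Z}^{n+1}\to\mathbb{Z}^n$ is the following. The state is $X=(x[1],\ldots,x[n])\in\mathbb{Z}^n$; initially $X$ is an arbitrary element of $\mathbb{Z}^n$ supplied by the user. While $x[1]>0$ and $x[2]>0$ and $\cdots$ and $x[n]>0$, the user chooses $\mathrm{control}=i\in\{1,\ldots,m\}$ and an integer $u\in\mathbb{Z}$, and $X$ is replaced by $g_i(X,u)$. Formally $S=I=\mathbb{Z}^n$, and $R(s,t)$ holds iff all coordinates of $s$ are positive and there exist $i\in\{1,\ldots,m\}$ and $u\in\mathbb{Z}$ with $t=g_i(s,u)$. A computation is a finite or infinite sequence of states $s_1,s_2,\ldots$ with $s_1\in I$, with $R(s_i,s_{i+1})$ for all consecutive terms, and such that if the sequence is finite with last state $s$ then there is no $t$ with $R(s,t)$. A computational segment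 is a finite sequence of states $t_1,\ldots,t_L$ such that $R(t_i,t_{i+1})$ for all $1\le i\le L-1$ (it is not required that $t_1\in I$ or that $t_L$ be terminal). -}

module Defs where

open import Data.Empty using (⊥)
open import Data.Fin using (Fin; zero; suc; inject₁; fromℕ)
open import Data.Integer using (ℤ; +_; -[1+_]; 0ℤ) renaming (_<_ to _<ℤ_)
open import Data.Nat using (ℕ; zero; suc; _+_; _*_; _<_)
open import Data.Product using (∃-syntax; _×_)
open import Data.Unit using (⊤)
open import Data.Vec using (Vec; []; _∷_; _∷ʳ_; lookup; map)
open import Relation.Binary.PropositionalEquality using (_≡_)
open import Relation.Nullary using (¬_)

-- Kleene's μ-recursive functions; prec recurses on the first argument, its step
-- function receiving (a , previous value , xs), and mu minimises over the first argument.
data Code : ℕ → Set where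
  zer  : Code 0
  succ : Code 1
  proj : ∀ {k} → Fin k → Code k
  comp : ∀ {k l} → Code l → (Fin l → Code k) → Code k
  prec : ∀ {k} → Code k → Code (2 + k) → Code (1 + k)
  mu   : ∀ {k} → Code (1 + k) → Code k

infix 4 _[_]⇓_

-- c [ xs ]⇓ y : the partial function with code c is defined at xs, with value y.
data _[_]⇓_ : ∀ {k} → Code k → Vec ℕ k → ℕ → Set where
  ⇓zer   : zer [ [] ]⇓ 0
  ⇓succ  : ∀ {x} → succ [ x ∷ [] ]⇓ suc x
  ⇓proj  : ∀ {k} {j : Fin k} {xs} → proj j [ xs ]⇓ lookup xs j
  ⇓comp  : ∀ {k l} {c : Code l} {ds : Fin l → Code k} {xs} ys {z} →
           (∀ j → ds j [ xs ]⇓ lookup ys j) → c [ ys ]⇓ z → comp c ds [ xs ]⇓ z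
  ⇓prec₀ : ∀ {k} {c : Code k} {d xs y} →
           c [ xs ]⇓ y → prec c d [ 0 ∷ xs ]⇓ y
  ⇓precₛ : ∀ {k} {c : Code k} {d xs a y z} →
           prec c d [ a ∷ xs ]⇓ y → d [ a ∷ y ∷ xs ]⇓ z → prec c d [ suc a ∷ xs ]⇓ z
  ⇓mu    : ∀ {k} {c : Code (1 + k)} {xs y} →
           c [ y ∷ xs ]⇓ 0 → (∀ a → a < y → ∃[ w ] c [ a ∷ xs ]⇓ suc w) → mu c [ xs ]⇓ y

-- The usual bijection ℤ → ℕ, through which computability on ℤ is read on ℕ.
encode : ℤ → ℕ
encode (+ k)    = 2 * k
encode -[1+ k ] = 1 + 2 * k

Computable : ∀ {k l} → (Vec ℤ k → Vec ℤ l) → Set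
Computable {k} {l} g = ∀ (j : Fin l) → ∃[ c ] (∀ x → c [ map encode x ]⇓ encode (lookup (g x) j))

record Program : Set₁ where
  field
    S : Set
    I : S → Set
    R : S → S → Set

module _ (P : Program) where
  open Program P

  -- t₁ , … , t_L with L = suc l is t zero , … , t (fromℕ l).
  IsSegment : ∀ {l} → (Fin (suc l) → S) → Set
  IsSegment {l} t = ∀ (i : Fin l) → R (t (inject₁ i)) (t (suc i))

  -- Finite sequences are non-empty since a computation has a first state.
  data Sequence : Set where
    finite   : ∀ {l} → (Fin (suc l) → S) → Sequence
    infinite : (ℕ → S) → Sequence

  IsComputation : Sequence → Set
  IsComputation (finite {l} s) = I (s zero) × IsSegment s × ¬ (∃[ t ] R (s (fromℕ l)) t)
  IsComputation (infinite s)   = I (s 0) × (∀ i → R (s i) (s (suc i)))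

  IsFinite : Sequence → Set
  IsFinite (finite _)   = ⊤
  IsFinite (infinite _) = ⊥

whileProgram : ∀ {n m} → (Fin m → Vec ℤ (suc n) → Vec ℤ n) → Program
whileProgram {n} {m} g = record
  { S = Vec ℤ n
  ; I = λ _ → ⊤
  ; R = λ s t → (∀ j → 0ℤ <ℤ lookup s j) × (∃[ i ] ∃[ u ] t ≡ g i (s ∷ʳ u))
  }

{-# OPTIONS --safe #-}
module Submission where

open import Data.Empty using (⊥-elim)
open import Data.Fin using (Fin; zero; suc; fromℕ; toℕ)
open import Data.Fin.Properties using (toℕ-fromℕ; toℕ-inject₁)
open import Data.Integer using (ℤ)
open import Data.Nat using (ℕ; zero; suc; _+_; _∸_; _<_; _≤_; _≤?_; s≤s)
open import Data.Nat.Induction using (<-rec)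
open import Data.Nat.Properties using (≤-refl; ≤-trans; <⇒≤; ≰⇒>; <⇒≱; m<n⇒0<n∸m; m∸n+n≡m)
open import Data.Product using (∃-syntax; Σ-syntax; _×_; _,_; proj₁; proj₂)
open import Data.Unit using (tt)
open import Data.Vec using (Vec)
open import Function using (_∘_)
open import Level using (0ℓ)
open import Relation.Binary.PropositionalEquality using (_≡_; refl; cong; subst; sym; trans)
open import Relation.Nullary using (¬_; yes; no)
open import Relation.Unary using (Pred; _⊆_; U)
open import Defs

-- Along an infinite computation s every fₖ ∘ s is a sequence of naturals. The indices
-- of an infinite set at which such a sequence is at most all its later values in that set
-- again form an infinite set, on which the sequence is monotone. Refining once for each k
-- gives i < j with fₖ (sᵢ) ≤ fₖ (sⱼ) for all k, so the segment sᵢ , … , sⱼ has no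
-- decreasing fₖ. As the goal is ⊥, double-negated infinitude of the index sets suffices,
-- which makes the argument constructive.

Infinite : Pred ℕ 0ℓ → Set
Infinite A = ∀ n → ¬ (∀ i → n ≤ i → ¬ A i)

MonotoneOn : Pred ℕ 0ℓ → (ℕ → ℕ) → Set
MonotoneOn A f = ∀ {i j} → A i → A j → i < j → f i ≤ f j

LaterMinimum : (ℕ → ℕ) → Pred ℕ 0ℓ → Pred ℕ 0ℓ
LaterMinimum f A i = A i × (∀ j → i < j → A j → f i ≤ f j)

-- Infinite descent on values: if no index from `n` on is a later minimum, each `i` in `A` from `n`
-- on has a later `j` in `A` with a smaller value, so strong induction rules out every value.
laterMinimum-infinite : ∀ f {A} → Infinite A → Infinite (LaterMinimum f A)
laterMinimum-infinite f {A} inf n none =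
  inf n λ i n≤i Ai → noValue (f i) i n≤i Ai refl
  where
  noValue : ∀ v i → n ≤ i → A i → ¬ (f i ≡ v)
  noValue = <-rec _ step
    where
    step : ∀ v → (∀ {w} → w < v → ∀ i → n ≤ i → A i → ¬ (f i ≡ w)) →
           ∀ i → n ≤ i → A i → ¬ (f i ≡ v)
    step _ rec i n≤i Ai refl = none i n≤i (Ai , minimal)
      where
      minimal : ∀ j → i < j → A j → f i ≤ f j
      minimal j i<j Aj with f i ≤? f j
      ... | yes fi≤fj = fi≤fj
      ... | no  fi≰fj = ⊥-elim (rec (≰⇒> fi≰fj) j (≤-trans n≤i (<⇒≤ i<j)) Aj refl)

monotoneSubset : ∀ M (f : Fin M → ℕ → ℕ) {A} → Infinite A →
                 ∃[ B ] (B ⊆ A × Infinite B × (∀ k → MonotoneOn B (f k)))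
monotoneSubset zero    f {A} inf = A , (λ Ai → Ai) , inf , λ ()
monotoneSubset (suc M) f {A} inf
  with monotoneSubset M (f ∘ suc) (laterMinimum-infinite (f zero) inf)
... | B , B⊆L , infB , mono = B , proj₁ ∘ B⊆L , infB , mono′
  where
  mono′ : ∀ k → MonotoneOn B (f k)
  -- `f zero` was handled first; its monotonicity survives the later refinements since `B` stays
  -- inside its later minima.
  mono′ zero    Bi Bj i<j = proj₂ (B⊆L Bi) _ i<j (proj₁ (B⊆L Bj))
  mono′ (suc k) = mono k

-- Dickson's lemma, weakened by a double negation.
dickson : ∀ M (f : Fin M → ℕ → ℕ) →
          ¬ (∀ i j → i < j → ¬ (∀ k → f k i ≤ f k j))
dickson M f bad with monotoneSubset M f {U} (λ n none → none n ≤-refl tt)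
... | B , _ , infB , mono =
  -- Asking for `j` from `suc i` on forces `i < j`.
  infB 0 λ i _ Bi → infB (suc i) λ j i<j Bj → bad i j i<j λ k → mono k Bi Bj i<j

module _ (P : Program) where
  open Program P

  noInfiniteRun : ∀ {M} (f : Fin M → S → ℕ) →
    (∀ l (t : Fin (suc l) → S) → 2 ≤ suc l → IsSegment P t →
      ∃[ k ] f k (t (fromℕ l)) < f k (t zero)) →
    ∀ (s : ℕ → S) → ¬ (∀ i → R (s i) (s (suc i)))
  noInfiniteRun {M} f decreases s run = dickson M (λ k → f k ∘ s) bad
    where
    bad : ∀ i j → i < j → ¬ (∀ k → f k (s i) ≤ f k (s j))
    -- The segment from `s i` to `s j` has `suc (j ∸ i)` states, at least two because `i < j`.
    bad i j i<j le with decreases (j ∸ i) t (s≤s (m<n⇒0<n∸m i<j)) segment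
      where
      t : Fin (suc (j ∸ i)) → S
      t a = s (toℕ a + i)
      segment : IsSegment P t
      segment a = subst (λ b → R (s (b + i)) (s (suc (toℕ a + i))))
                        (sym (toℕ-inject₁ a)) (run (toℕ a + i))
    ... | k , drop = <⇒≱ (subst (λ b → f k (s b) < f k (s i)) end drop) (le k)
      where
      end : toℕ (fromℕ (j ∸ i)) + i ≡ j
      end = trans (cong (_+ i) (toℕ-fromℕ (j ∸ i))) (m∸n+n≡m (<⇒≤ i<j))

theorem7p2 : ∀ (n m : ℕ) → 1 ≤ n → 1 ≤ m →
    (g : Fin m → Vec ℤ (suc n) → Vec ℤ n) →
    (∀ i → Computable (g i)) →
    (Σ[ M ∈ ℕ ] Σ[ f ∈ (Fin M → Vec ℤ n → ℕ) ]
    (∀ l (t : Fin (suc l) → Vec ℤ n) → 2 ≤ suc l → IsSegment (whileProgram g) t →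
    ∃[ k ] f k (t (fromℕ l)) < f k (t zero))) →
    ∀ (c : Sequence (whileProgram g)) → IsComputation (whileProgram g) c → IsFinite (whileProgram g) c
theorem7p2 n m _ _ g _ _                   (finite _)   _         = tt
theorem7p2 n m _ _ g _ (M , f , decreases) (infinite s) (_ , run) =
  noInfiniteRun (whileProgram g) f decreases s run
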